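{- For Online Makespan Scheduling under Scenarios with $m=2$ machines and $K=2$ scenarios, there exists no deterministic online algorithm with competitive ratio strictly smaller than $\frac{9+\sqrt{17}}{8}$.
   Context: Online Makespan Scheduling under Scenarios with $m$ machines and $K$ scenarios (both known in advance): an instance consists of $n$ jobs with processing times $p_j\ge0$ and scenarios $S_1,\dots,S_K\subseteq[n]$ (not known in advance); jobs are revealed in order $1,\dots,n$, and on revelation of job $j$ the algorithm learns $p_j$ and which scenarios contain $j$, and must irrevocably assign $j$ to a machine $\tau(j)\in[m]$. With $J_i=\tau^{ -1}(i)$ and $p(S)=\sum_{j\in S}p_j$, the makespan is $\max_{k}\max_i p(J_i\cap S_k)$; the competitive ratio of an algorithm is the supremum over instances of its makespan divided by the offline optimum (minimum makespan over all partitions of $[n]$ into $m$ machines). -}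

module Defs where

open import Data.Bool using (Bool; true; false; if_then_else_; _∧_)
open import Data.Fin using (Fin; zero; suc; _≟_)
open import Data.List using (List; []; _∷_; _++_; [_]; concatMap; map; foldr)
open import Data.List.Relation.Unary.All using (All)
open import Data.Product using (_×_; _,_; proj₁; proj₂)
open import Data.Sum using (_⊎_)
open import Data.Integer using (+_)
open import Data.Rational using (ℚ; 0ℚ; _+_; _*_; _-_; _⊔_; _⊓_; _≤_; _<_; _/_)
open import Relation.Nullary using (does)

Machine : Set
Machine = Fin 2

Scenario : Set
Scenario = Fin 2

-- A revealed job: its processing time p_j and the indicator of which
-- scenarios contain it (k ↦ true iff j ∈ S_k).
Job : Set
Job = ℚ × (Scenario → Bool)

-- An instance is the list of jobs in revelation order 1..n;
-- it is valid when all processing times are nonnegative.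
ValidInstance : List Job → Set
ValidInstance js = All (λ j → 0ℚ ≤ proj₁ j) js

-- A deterministic online algorithm: given the history of previously revealed
-- jobs (in order) and the newly revealed job, it picks a machine irrevocably.
OnlineAlgorithm : Set
OnlineAlgorithm = List Job → Job → Machine

Schedule : Set
Schedule = List (Job × Machine)

runFrom : OnlineAlgorithm → List Job → List Job → Schedule
runFrom alg hist []       = []
runFrom alg hist (j ∷ js) = (j , alg hist j) ∷ runFrom alg (hist ++ [ j ]) js

run : OnlineAlgorithm → List Job → Schedule
run alg js = runFrom alg [] js

load : Schedule → Scenario → Machine → ℚ
load []                  k i = 0ℚ
load (((p , s) , t) ∷ a) k i =
  (if does (t ≟ i) ∧ s k then p else 0ℚ) + load a k i

makespan : Schedule → ℚ
makespan a = (load a zero zero ⊔ load a zero (suc zero))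
           ⊔ (load a (suc zero) zero ⊔ load a (suc zero) (suc zero))

allSchedules : List Job → List Schedule
allSchedules []       = [] ∷ []
allSchedules (j ∷ js) =
  concatMap (λ a → ((j , zero) ∷ a) ∷ ((j , suc zero) ∷ a) ∷ []) (allSchedules js)

minimumℚ : List ℚ → ℚ
minimumℚ []       = 0ℚ
minimumℚ (x ∷ xs) = foldr _⊓_ x xs

opt : List Job → ℚ
opt js = minimumℚ (map makespan (allSchedules js))

Competitive : OnlineAlgorithm → ℚ → Set
Competitive alg ρ = (js : List Job) → ValidInstance js → makespan (run alg js) ≤ ρ * opt js

-- ρ < (9 + √17)/8  ⇔  8ρ - 9 < √17  ⇔  8ρ - 9 ≤ 0  or  (8ρ - 9)² < 17.
BelowBound : ℚ → Set
BelowBound ρ = (x ≤ 0ℚ) ⊎ (x * x < + 17 / 1)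
  where x = (+ 8 / 1) * ρ - (+ 9 / 1)

{-# OPTIONS --safe #-}
-- The adversary uses jobs whose sizes are combinations m·β + n·δ of two positive
-- rationals; normalise 4β + δ = 1, so that β ≈ 0.219.  Two S₂-jobs of size β have
-- to be separated; then come S₁-jobs of sizes β and 1.  If these two share a
-- machine, two further jobs of size at most 1 and a common job of size 1 + 4β win.
-- If they are separated, an S₂-job of size 2 − 2β comes next, then an S₁-job of
-- the same size or a common job of size 1 − β, and finally a common job of size
-- 3 − β.  The decisive ratios are (3 − 2β)/(2 − 2β) and (5 − 2β)/(3 − β); they
-- agree when 2β² − 5β + 1 = 0, where both equal (9 + √17)/8.  For rational
-- σ > 18/11 below that value, β = 7/2 − 2σ makes both of them exceed σ.
module Submission where

open import Defs
open import Data.Bool using (Bool; true; false; if_then_else_; _∧_)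
open import Data.Fin using (zero; suc; _≟_)
open import Data.Fin.Properties using (all?; any?)
open import Data.Integer using (+_)
open import Data.List using (List; []; _∷_; _++_; [_]; map; foldr)
open import Data.List.Membership.Propositional using (_∈_)
open import Data.List.Membership.Propositional.Properties using (∈-map⁺; ∈-concatMap⁺)
open import Data.List.Properties using (map-++; ++-assoc; ++-identityʳ)
open import Data.List.Relation.Unary.All using (All; []; _∷_; lookupAny)
open import Data.List.Relation.Unary.Any as Any using (Any; here; there)
open import Data.Nat as ℕ using (ℕ; zero; suc)
open import Data.Product using (_×_; _,_; proj₁; proj₂; ∃)
open import Data.Product.Properties using (≡-dec)
open import Data.Rational using (ℚ; 0ℚ; 1ℚ; _+_; _*_; _-_; -_; _⊓_; _⊔_; _≤_; _<_; _/_; Positive; positive; nonNegative)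
open import Data.Rational.Properties hiding (_≟_)
open import Data.Rational.Solver using (module +-*-Solver)
open import Data.Sum using (inj₁; inj₂)
open import Data.Unit using (tt)
open import Relation.Binary.PropositionalEquality using (_≡_; refl; sym; trans; cong; cong₂; subst)
open import Relation.Nullary using (¬_; Dec; does; contradiction)
open import Relation.Nullary.Decidable using (_×-dec_; toWitness; from-yes)

open import Algebra.Properties.Monoid.Mult +-0-monoid using (×-homo-+) renaming (_×_ to _·_)
open +-*-Solver using (solve; con; _:+_; _:*_; _:-_; _:=_; Polynomial)

-- Bounds on the optimum and the makespan, and runs extended by one job.

foldr-⊓-≤-seed : ∀ x xs → foldr _⊓_ x xs ≤ x
foldr-⊓-≤-seed x []       = ≤-refl
foldr-⊓-≤-seed x (y ∷ xs) = ≤-trans (p⊓q≤q y _) (foldr-⊓-≤-seed x xs)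

foldr-⊓-≤ : ∀ x {xs y} → y ∈ xs → foldr _⊓_ x xs ≤ y
foldr-⊓-≤ x (here refl) = p⊓q≤p _ _
foldr-⊓-≤ x {z ∷ _} (there y∈xs) = ≤-trans (p⊓q≤q z _) (foldr-⊓-≤ x y∈xs)

minimum-≤ : ∀ {xs y} → y ∈ xs → minimumℚ xs ≤ y
minimum-≤ {x ∷ xs} (here refl)  = foldr-⊓-≤-seed x xs
minimum-≤ {x ∷ xs} (there y∈xs) = foldr-⊓-≤ x y∈xs

∈-allSchedules : ∀ a → a ∈ allSchedules (map proj₁ a)
∈-allSchedules []            = here refl
∈-allSchedules ((j , m) ∷ a) =
  ∈-concatMap⁺ _ (Any.map (λ { refl → choice m }) (∈-allSchedules a))
  where
  choice : ∀ m → ((j , m) ∷ a) ∈ ((j , zero) ∷ a) ∷ ((j , suc zero) ∷ a) ∷ []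
  choice zero       = here refl
  choice (suc zero) = there (here refl)

-- Lets one exhibited offline schedule bound the optimum, since it occurs among `allSchedules` of
-- its own jobs.
opt-≤ : ∀ a → opt (map proj₁ a) ≤ makespan a
opt-≤ a = minimum-≤ (∈-map⁺ makespan (∈-allSchedules a))

load-≤-makespan : ∀ a k i → load a k i ≤ makespan a
load-≤-makespan a k i = ≤-trans (≤-scenario k i) (scenario-≤ k)
  where
  scenario : Scenario → ℚ
  scenario k = load a k zero ⊔ load a k (suc zero)

  ≤-scenario : ∀ k i → load a k i ≤ scenario k
  ≤-scenario k zero       = p≤p⊔q (load a k zero) (load a k (suc zero))
  ≤-scenario k (suc zero) = p≤q⊔p (load a k zero) (load a k (suc zero))

  scenario-≤ : ∀ k → scenario k ≤ makespan a
  scenario-≤ zero       = p≤p⊔q (scenario zero) (scenario (suc zero))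
  scenario-≤ (suc zero) = p≤q⊔p (scenario zero) (scenario (suc zero))

makespan-≤ : ∀ a {u} → (∀ k i → load a k i ≤ u) → makespan a ≤ u
makespan-≤ a h = ⊔-lub (⊔-lub (h zero zero) (h zero (suc zero)))
                       (⊔-lub (h (suc zero) zero) (h (suc zero) (suc zero)))

runFrom-∷ʳ : ∀ alg hist js j →
  runFrom alg hist (js ++ [ j ]) ≡ runFrom alg hist js ++ [ j , alg (hist ++ js) j ]
runFrom-∷ʳ alg hist []       j = cong (λ h → [ j , alg h j ]) (sym (++-identityʳ hist))
runFrom-∷ʳ alg hist (i ∷ js) j = cong ((i , alg hist i) ∷_)
  (trans (runFrom-∷ʳ alg (hist ++ [ i ]) js j)
         (cong (λ h → runFrom alg (hist ++ [ i ]) js ++ [ j , alg h j ]) (++-assoc hist [ i ] js)))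

-- A single unit job has optimum 1 and makespan at least 1. The sign of `ρ` is what lets an upper
-- bound on the optimum be multiplied by `ρ`.
competitive⇒0≤ : ∀ alg {ρ} → Competitive alg ρ → 0ℚ ≤ ρ
competitive⇒0≤ alg {ρ} comp = ≤-trans (from-yes (0ℚ ≤? 1ℚ)) (≤-trans 1≤makespan makespan≤ρ)
  where
  unitJob : Job
  unitJob = 1ℚ , λ _ → true

  1≤makespan : 1ℚ ≤ makespan (run alg [ unitJob ])
  1≤makespan with alg [] unitJob
  ... | zero     = ≤-refl
  ... | suc zero = ≤-refl

  makespan≤ρ : makespan (run alg [ unitJob ]) ≤ ρ
  makespan≤ρ = subst (makespan (run alg [ unitJob ]) ≤_) (*-identityʳ ρ)
                 (comp [ unitJob ] (from-yes (0ℚ ≤? 1ℚ) ∷ []))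

-- Symbolic sizes and the decidable adversary game.

-- The pair (m , n) stands for the size m·β + n·δ.
Size : Set
Size = ℕ × ℕ

infixl 6 _⊕_
infix  4 _≼_ _≼?_

_⊕_ : Size → Size → Size
(m , n) ⊕ (m′ , n′) = m ℕ.+ m′ , n ℕ.+ n′

-- Componentwise, hence decidable and sound for all nonnegative β and δ at once.
_≼_ : Size → Size → Set
(m , n) ≼ (m′ , n′) = m ℕ.≤ m′ × n ℕ.≤ n′

_≼?_ : ∀ s t → Dec (s ≼ t)
(m , n) ≼? (m′ , n′) = (m ℕ.≤? m′) ×-dec (n ℕ.≤? n′)

SymbolicJob : Set
SymbolicJob = Size × (Scenario → Bool)

Play : Set
Play = List (SymbolicJob × Machine)

symbolicLoad : Play → Scenario → Machine → Size
symbolicLoad []                  k i = 0 , 0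
symbolicLoad (((s , S) , m) ∷ h) k i =
  (if does (m ≟ i) ∧ S k then s else (0 , 0)) ⊕ symbolicLoad h k i

-- Jobs beyond the end of the list of machines go to machine zero.
reassign : Play → List Machine → Play
reassign []            _        = []
reassign ((j , _) ∷ h) []       = (j , zero) ∷ reassign h []
reassign ((j , _) ∷ h) (m ∷ ms) = (j , m) ∷ reassign h ms

-- `stop ms u` claims victory: assigning the jobs to ms has makespan at most u.
data Strategy : Set where
  stop    : List Machine → Size → Strategy
  present : SymbolicJob → (Machine → Strategy) → Strategy

-- Pairs (u , l) for which an online load l against an offline makespan u
-- refutes the competitive ratio.
thresholds : List (Size × Size)
thresholds = ((1 , 0)  , (2 , 0))
           ∷ ((4 , 1)  , (7 , 1))
           ∷ ((8 , 1)  , (13 , 2))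
           ∷ ((8 , 1)  , (14 , 1))
           ∷ ((6 , 2)  , (10 , 3))
           ∷ ((11 , 3) , (18 , 5))
           ∷ []

-- The load may overshoot its threshold: one branch of `togetherStrategy` ends with 8β + δ where 7β
-- + δ suffices.
Exceeds : Size → Size → Set
Exceeds u l = Any (λ t → proj₁ t ≡ u × proj₂ t ≼ l) thresholds

Wins : Play → Strategy → Set
Wins h (stop ms u)   = (∀ k i → symbolicLoad (reassign h ms) k i ≼ u)
                     × ∃ λ k → ∃ λ i → Exceeds u (symbolicLoad h k i)
Wins h (present j f) = ∀ m → Wins (h ++ [ j , m ]) (f m)

wins? : ∀ h s → Dec (Wins h s)
wins? h (stop ms u)   =
  all? (λ k → all? λ i → symbolicLoad (reassign h ms) k i ≼? u)
  ×-dec any? (λ k → any? λ i → Any.any?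
          (λ t → ≡-dec ℕ._≟_ ℕ._≟_ (proj₁ t) u ×-dec (proj₂ t ≼? symbolicLoad h k i)) thresholds)
wins? h (present j f) = all? λ m → wins? (h ++ [ j , m ]) (f m)

-- The adversary's strategy.

only : Scenario → Scenario → Bool
only k k′ = does (k ≟ k′)

both : Scenario → Bool
both _ = true

S₁ S₂ : Scenario → Bool
S₁ = only zero
S₂ = only (suc zero)

-- Here `m` carries both S₁-jobs, so its S₁-load is 5β + δ, and each machine has S₂-load β.
togetherStrategy : Machine → Strategy
togetherStrategy m =
  present ((2 , 0) , S₂) λ m₅ → if does (m₅ ≟ m)
    then (present ((4 , 1) , S₂) λ m₆ → if does (m₆ ≟ m)
      then stop (zero ∷ zero ∷ zero ∷ suc zero ∷ zero ∷ suc zero ∷ []) (4 , 1)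
      -- The S₁-load of `m` and the S₂-load of the other machine are both 5β + δ, so either reply
      -- yields 13β + 2δ.
      else present ((8 , 1) , both) λ _ →
             stop (zero ∷ zero ∷ zero ∷ zero ∷ zero ∷ zero ∷ suc zero ∷ []) (8 , 1))
    else (present ((3 , 0) , both) λ m₆ → if does (m₆ ≟ m)
      then stop (zero ∷ zero ∷ suc zero ∷ zero ∷ zero ∷ suc zero ∷ []) (4 , 1)
      -- Now the other machine has S₂-load 6β: the replies yield 13β + 2δ on `m` and 14β + δ on the
      -- other.
      else present ((8 , 1) , both) λ _ →
             stop (zero ∷ zero ∷ zero ∷ zero ∷ zero ∷ zero ∷ suc zero ∷ []) (8 , 1))

-- Here `m` carries the S₁-job of size 4β + δ, and the other machine the one of size β.
apartStrategy : Machine → Strategy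
apartStrategy m =
  present ((6 , 2) , S₂) λ m₅ → if does (m₅ ≟ m)
    then (present ((6 , 2) , S₁) λ m₆ → if does (m₆ ≟ m)
      then stop (zero ∷ zero ∷ zero ∷ zero ∷ suc zero ∷ suc zero ∷ []) (6 , 2)
      else finish)
    else (present ((3 , 1) , both) λ m₆ → if does (m₆ ≟ m)
      then finish
      else stop (zero ∷ zero ∷ zero ∷ suc zero ∷ suc zero ∷ zero ∷ []) (6 , 2))
  where
  -- When this is reached, each machine has load 7β + 2δ in some scenario, so the common job raises
  -- one of them to 18β + 5δ wherever it goes.
  finish : Strategy
  finish = present ((11 , 3) , both) λ _ →
    stop (zero ∷ zero ∷ zero ∷ zero ∷ zero ∷ zero ∷ suc zero ∷ []) (11 , 3)

strategy : Strategy
strategy =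
  present ((1 , 0) , S₂) λ m₁ →
  present ((1 , 0) , S₂) λ m₂ → if does (m₁ ≟ m₂)
    then stop (zero ∷ suc zero ∷ []) (1 , 0)
    else (present ((1 , 0) , S₁) λ m₃ →
          present ((4 , 1) , S₁) λ m₄ → if does (m₃ ≟ m₄)
            then togetherStrategy m₄
            else apartStrategy m₄)

-- The game tree is finite and its sizes are numerals, so evaluation settles it before β and δ are
-- chosen.
strategy-wins : Wins [] strategy
strategy-wins = toWitness {a? = wins? [] strategy} tt

-- From symbolic plays to actual runs.

module Interpretation (β δ : ℚ) (0≤β : 0ℚ ≤ β) (0≤δ : 0ℚ ≤ δ) where

  ⟦_⟧ : Size → ℚ
  ⟦ m , n ⟧ = m · β + n · δ

  ⟦_⟧ʲ : SymbolicJob → Job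
  ⟦ s , S ⟧ʲ = ⟦ s ⟧ , S

  ⟦_⟧ᵖ : Play → Schedule
  ⟦_⟧ᵖ = map λ (j , m) → ⟦ j ⟧ʲ , m

  0≤· : ∀ n {q} → 0ℚ ≤ q → 0ℚ ≤ n · q
  0≤· zero    0≤q = ≤-refl
  0≤· (suc n) 0≤q = +-mono-≤ 0≤q (0≤· n 0≤q)

  ·-monoˡ-≤ : ∀ {m n q} → 0ℚ ≤ q → m ℕ.≤ n → m · q ≤ n · q
  ·-monoˡ-≤ {n = n} 0≤q ℕ.z≤n = 0≤· n 0≤q
  ·-monoˡ-≤ {q = q} 0≤q (ℕ.s≤s m≤n) = +-monoʳ-≤ q (·-monoˡ-≤ 0≤q m≤n)

  0≤⟦_⟧ : ∀ s → 0ℚ ≤ ⟦ s ⟧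
  0≤⟦ m , n ⟧ = +-mono-≤ (0≤· m 0≤β) (0≤· n 0≤δ)

  ⟦⟧-mono : ∀ {s t} → s ≼ t → ⟦ s ⟧ ≤ ⟦ t ⟧
  ⟦⟧-mono (m≤m′ , n≤n′) = +-mono-≤ (·-monoˡ-≤ 0≤β m≤m′) (·-monoˡ-≤ 0≤δ n≤n′)

  ⟦⟧-⊕ : ∀ s t → ⟦ s ⊕ t ⟧ ≡ ⟦ s ⟧ + ⟦ t ⟧
  ⟦⟧-⊕ (m , n) (m′ , n′) = trans (cong₂ _+_ (×-homo-+ β m m′) (×-homo-+ δ n n′))
    (solve 4 (λ a b c d → (a :+ b) :+ (c :+ d) := (a :+ c) :+ (b :+ d)) refl
       (m · β) (m′ · β) (n · δ) (n′ · δ))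

  ⟦⟧-if : ∀ c s → (if c then ⟦ s ⟧ else 0ℚ) ≡ ⟦ (if c then s else (0 , 0)) ⟧
  ⟦⟧-if true  s = refl
  ⟦⟧-if false s = refl

  load-⟦⟧ : ∀ h k i → load ⟦ h ⟧ᵖ k i ≡ ⟦ symbolicLoad h k i ⟧
  load-⟦⟧ []                  k i = refl
  load-⟦⟧ (((s , S) , m) ∷ h) k i =
    trans (cong₂ _+_ (⟦⟧-if (does (m ≟ i) ∧ S k) s) (load-⟦⟧ h k i))
          (sym (⟦⟧-⊕ (if does (m ≟ i) ∧ S k then s else (0 , 0)) (symbolicLoad h k i)))

  jobs : Play → List Job
  jobs h = map proj₁ ⟦ h ⟧ᵖ

  jobs-reassign : ∀ h ms → jobs (reassign h ms) ≡ jobs h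
  jobs-reassign []            ms       = refl
  jobs-reassign ((j , _) ∷ h) []       = cong (⟦ j ⟧ʲ ∷_) (jobs-reassign h [])
  jobs-reassign ((j , _) ∷ h) (m ∷ ms) = cong (⟦ j ⟧ʲ ∷_) (jobs-reassign h ms)

  jobs-valid : ∀ h → ValidInstance (jobs h)
  jobs-valid []                  = []
  jobs-valid (((s , _) , _) ∷ h) = 0≤⟦ s ⟧ ∷ jobs-valid h

  jobs-∷ʳ : ∀ h j m → jobs (h ++ [ j , m ]) ≡ jobs h ++ [ ⟦ j ⟧ʲ ]
  jobs-∷ʳ []      j m = refl
  jobs-∷ʳ (x ∷ h) j m = cong (_ ∷_) (jobs-∷ʳ h j m)

  opt-≤-reassign : ∀ h ms u → (∀ k i → symbolicLoad (reassign h ms) k i ≼ u) → opt (jobs h) ≤ ⟦ u ⟧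
  opt-≤-reassign h ms u loads≼u = subst (λ js → opt js ≤ ⟦ u ⟧) (jobs-reassign h ms)
    (≤-trans (opt-≤ ⟦ reassign h ms ⟧ᵖ) (makespan-≤ ⟦ reassign h ms ⟧ᵖ λ k i →
      subst (_≤ ⟦ u ⟧) (sym (load-⟦⟧ (reassign h ms) k i)) (⟦⟧-mono (loads≼u k i))))

  module _ {ρ σ : ℚ} (0≤ρ : 0ℚ ≤ ρ) (ρ≤σ : ρ ≤ σ)
           (refutes : All (λ t → σ * ⟦ proj₁ t ⟧ < ⟦ proj₂ t ⟧) thresholds) where

    exceeds : ∀ {u l} → Exceeds u l → σ * ⟦ u ⟧ < ⟦ l ⟧
    exceeds {l = l} e with lookupAny refutes e
    ... | σu<l′ , u′≡u , l′≼l =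
      <-≤-trans (subst (λ v → σ * ⟦ v ⟧ < ⟦ proj₂ (Any.lookup e) ⟧) u′≡u σu<l′) (⟦⟧-mono {t = l} l′≼l)

    -- Invariant: the play `h` is exactly the run of `alg` on its jobs; each presented job is
    -- answered by the reply of `alg` itself. The sizes are tuned to `σ`, yet they refute every `ρ`
    -- up to `σ`.
    wins⇒¬competitive : ∀ alg s h → run alg (jobs h) ≡ ⟦ h ⟧ᵖ → Wins h s → ¬ Competitive alg ρ
    wins⇒¬competitive alg (stop ms u) h run≡h (loads≼u , k , i , e) comp = <-irrefl refl (begin-strict
      σ * ⟦ u ⟧                     <⟨ exceeds e ⟩
      ⟦ symbolicLoad h k i ⟧        ≡⟨ load-⟦⟧ h k i ⟨
      load ⟦ h ⟧ᵖ k i               ≤⟨ load-≤-makespan ⟦ h ⟧ᵖ k i ⟩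
      makespan ⟦ h ⟧ᵖ               ≡⟨ cong makespan run≡h ⟨
      makespan (run alg (jobs h))   ≤⟨ comp (jobs h) (jobs-valid h) ⟩
      ρ * opt (jobs h)              ≤⟨ *-monoˡ-≤-nonNeg ρ {{nonNegative 0≤ρ}} (opt-≤-reassign h ms u loads≼u) ⟩
      ρ * ⟦ u ⟧                     ≤⟨ *-monoʳ-≤-nonNeg ⟦ u ⟧ {{nonNegative 0≤⟦ u ⟧}} ρ≤σ ⟩
      σ * ⟦ u ⟧                     ∎)
      where open ≤-Reasoning
    wins⇒¬competitive alg (present j f) h run≡h wins =
      wins⇒¬competitive alg (f m) (h ++ [ j , m ]) extended (wins m)
      where
      m : Machine
      m = alg (jobs h) ⟦ j ⟧ʲ

      extended : run alg (jobs (h ++ [ j , m ])) ≡ ⟦ h ++ [ j , m ] ⟧ᵖ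
      extended = trans (cong (run alg) (jobs-∷ʳ h j m))
        (trans (runFrom-∷ʳ alg [] (jobs h) ⟦ j ⟧ʲ)
        (trans (cong (_++ [ ⟦ j ⟧ʲ , m ]) run≡h)
               (sym (map-++ _ h [ j , m ]))))

-- Choice of β and δ, and positivity of the gaps.

*-pos : ∀ {p q} → 0ℚ < p → 0ℚ < q → 0ℚ < p * q
*-pos {p} {q} 0<p 0<q = positive⁻¹ (p * q) {{pos*pos⇒pos p {{positive 0<p}} q {{positive 0<q}}}}

+-pos : ∀ {p q} → 0ℚ < p → 0ℚ < q → 0ℚ < p + q
+-pos 0<p 0<q = +-mono-< 0<p 0<q

<-from-gap : ∀ {p q g} → 0ℚ < g → q ≡ p + g → p < q
<-from-gap {p} {q} {g} 0<g q≡p+g = begin-strict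
  p       ≡⟨ +-identityʳ p ⟨
  p + 0ℚ  <⟨ +-monoʳ-< p 0<g ⟩
  p + g   ≡⟨ q≡p+g ⟨
  q       ∎
  where open ≤-Reasoning

gap-pos : ∀ {p q} → p < q → 0ℚ < q - p
gap-pos {p} {q} p<q = subst (_< q - p) (+-inverseʳ p) (+-monoˡ-< (- p) p<q)

pos : ∀ q {{_ : Positive q}} → 0ℚ < q
pos q = positive⁻¹ q

-- Follows the recursion of `_·_`, so that solved identities match `⟦_⟧` definitionally.
_:·_ : ∀ {k} → ℕ → Polynomial k → Polynomial k
zero  :· e = con 0ℚ
suc n :· e = e :+ (n :· e)

-- At σ = 13/8 both δ and the third gap in `refutes`, which is (8σ - 13)(2σ - 3), vanish.
module LowerBound (σ : ℚ) (13<8σ : (+ 13 / 1) < (+ 8 / 1) * σ)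
  ([8σ-9]²<17 : ((+ 8 / 1) * σ - (+ 9 / 1)) * ((+ 8 / 1) * σ - (+ 9 / 1)) < + 17 / 1) where

  -- Here 4β + δ = 2.  Positivity of r = q + p² is the tangent bound σ < 105/64.
  β δ p q r : ℚ
  β = (+ 7 / 1) - (+ 4 / 1) * σ
  δ = (+ 16 / 1) * σ - (+ 26 / 1)
  p = (+ 8 / 1) * σ - (+ 13 / 1)
  q = (+ 17 / 1) - ((+ 8 / 1) * σ - (+ 9 / 1)) * ((+ 8 / 1) * σ - (+ 9 / 1))
  r = (+ 105 / 1) - (+ 64 / 1) * σ

  β′ δ′ p′ q′ r′ : Polynomial 1 → Polynomial 1
  β′ s = con (+ 7 / 1) :- con (+ 4 / 1) :* s
  δ′ s = con (+ 16 / 1) :* s :- con (+ 26 / 1)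
  p′ s = con (+ 8 / 1) :* s :- con (+ 13 / 1)
  q′ s = con (+ 17 / 1) :- (con (+ 8 / 1) :* s :- con (+ 9 / 1)) :* (con (+ 8 / 1) :* s :- con (+ 9 / 1))
  r′ s = con (+ 105 / 1) :- con (+ 64 / 1) :* s

  0<p : 0ℚ < p
  0<p = gap-pos 13<8σ

  0<q : 0ℚ < q
  0<q = gap-pos [8σ-9]²<17

  0<r : 0ℚ < r
  0<r = subst (0ℚ <_) (solve 1 (λ s → q′ s :+ p′ s :* p′ s := r′ s) refl σ)
    (+-pos 0<q (*-pos 0<p 0<p))

  scaled-pos : ∀ c d {x} {{_ : Positive c}} {{_ : Positive d}} → 0ℚ < x → 0ℚ < c * x + d
  scaled-pos c d 0<x = +-pos (*-pos (pos c) 0<x) (pos d)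

  0<β : 0ℚ < β
  0<β = subst (0ℚ <_) (solve 1 (λ s → con (+ 1 / 16) :* r′ s :+ con (+ 7 / 16) := β′ s) refl σ)
    (scaled-pos (+ 1 / 16) (+ 7 / 16) 0<r)

  0<δ : 0ℚ < δ
  0<δ = subst (0ℚ <_) (solve 1 (λ s → con (+ 2 / 1) :* p′ s := δ′ s) refl σ)
    (*-pos (pos (+ 2 / 1)) 0<p)

  open Interpretation β δ (<⇒≤ 0<β) (<⇒≤ 0<δ)

  ⟦_⟧′ : Size → Polynomial 1 → Polynomial 1
  ⟦ m , n ⟧′ s = (m :· β′ s) :+ (n :· δ′ s)

  refutes : All (λ t → σ * ⟦ proj₁ t ⟧ < ⟦ proj₂ t ⟧) thresholds
  refutes =
      <-from-gap (*-pos (scaled-pos (+ 1 / 64) (+ 23 / 64) 0<r) 0<β)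
        (solve 1 (λ s → ⟦ 2 , 0 ⟧′ s := s :* ⟦ 1 , 0 ⟧′ s
           :+ (con (+ 1 / 64) :* r′ s :+ con (+ 23 / 64)) :* β′ s) refl σ)
    -- The gap is 23 - 14σ, positive because 105/64 lies just below 23/14.
    ∷ <-from-gap (scaled-pos (+ 7 / 32) (+ 1 / 32) 0<r)
        (solve 1 (λ s → ⟦ 7 , 1 ⟧′ s := s :* ⟦ 4 , 1 ⟧′ s
           :+ (con (+ 7 / 32) :* r′ s :+ con (+ 1 / 32))) refl σ)
    ∷ <-from-gap (*-pos (scaled-pos (+ 1 / 4) (+ 1 / 4) 0<p) 0<p)
        (solve 1 (λ s → ⟦ 13 , 2 ⟧′ s := s :* ⟦ 8 , 1 ⟧′ s
           :+ (con (+ 1 / 4) :* p′ s :+ con (+ 1 / 4)) :* p′ s) refl σ)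
    -- The previous gap plus β - δ = 33 - 20σ.
    ∷ <-from-gap (+-pos (*-pos (scaled-pos (+ 1 / 4) (+ 1 / 4) 0<p) 0<p)
                        (scaled-pos (+ 5 / 16) (+ 3 / 16) 0<r))
        (solve 1 (λ s → ⟦ 14 , 1 ⟧′ s := s :* ⟦ 8 , 1 ⟧′ s
           :+ ((con (+ 1 / 4) :* p′ s :+ con (+ 1 / 4)) :* p′ s
               :+ (con (+ 5 / 16) :* r′ s :+ con (+ 3 / 16)))) refl σ)
    -- The two decisive gaps are multiples of the same `q`, which vanishes at σ = (9 + √17)/8.
    ∷ <-from-gap (*-pos (pos (+ 1 / 8)) 0<q)
        (solve 1 (λ s → ⟦ 10 , 3 ⟧′ s := s :* ⟦ 6 , 2 ⟧′ s :+ con (+ 1 / 8) :* q′ s) refl σ)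
    ∷ <-from-gap (*-pos (pos (+ 1 / 16)) 0<q)
        (solve 1 (λ s → ⟦ 18 , 5 ⟧′ s := s :* ⟦ 11 , 3 ⟧′ s :+ con (+ 1 / 16) :* q′ s) refl σ)
    ∷ []

  ¬competitive : ∀ alg {ρ} → ρ ≤ σ → ¬ Competitive alg ρ
  ¬competitive alg ρ≤σ comp =
    wins⇒¬competitive (competitive⇒0≤ alg comp) ρ≤σ refutes alg strategy [] refl strategy-wins comp

-- 18/11 is a rational strictly between 13/8 and (9 + √17)/8; sizes tuned to it handle all smaller
-- ratios.
13<8·18/11 : (+ 13 / 1) < (+ 8 / 1) * (+ 18 / 11)
13<8·18/11 = from-yes ((+ 13 / 1) <? (+ 8 / 1) * (+ 18 / 11))

mainTheorem7 : (alg : OnlineAlgorithm) (ρ : ℚ) → BelowBound ρ → ¬ Competitive alg ρ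
mainTheorem7 alg ρ below with ≤-total ρ (+ 18 / 11)
... | inj₁ ρ≤18/11 =
  LowerBound.¬competitive (+ 18 / 11) 13<8·18/11 (from-yes (x * x <? + 17 / 1)) alg ρ≤18/11
  where x = (+ 8 / 1) * (+ 18 / 11) - (+ 9 / 1)
... | inj₂ 18/11≤ρ = above below
  where
  13<8ρ : (+ 13 / 1) < (+ 8 / 1) * ρ
  13<8ρ = <-≤-trans 13<8·18/11 (*-monoˡ-≤-nonNeg (+ 8 / 1) 18/11≤ρ)

  0<8ρ-9 : 0ℚ < (+ 8 / 1) * ρ - (+ 9 / 1)
  0<8ρ-9 = <-trans (pos (+ 4 / 1)) (+-monoˡ-< (- (+ 9 / 1)) 13<8ρ)

  above : BelowBound ρ → ¬ Competitive alg ρ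
  above (inj₁ 8ρ-9≤0)     = contradiction (<-≤-trans 0<8ρ-9 8ρ-9≤0) (<-irrefl refl)
  above (inj₂ [8ρ-9]²<17) = LowerBound.¬competitive ρ 13<8ρ [8ρ-9]²<17 alg ≤-refl
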